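{- Suppose that the variety $\mathbf{K}$ of $E$-algebras satisfies (IT), coherence and the $\forall$-factorization property. Then: (1) if $E$ has finitary unification type, then $E$ has finitary simple-variable-restriction unification type; (2) if $E$ has unitary unification type and $\forall$-factorizations (in $\mathsf{Alg}^{op}_{fp}(E)$) can always be taken singular, then $E$ has unitary simple-variable-restriction unification type; (3) if $E$-unification is decidable and $\forall$-factorizations are computable, then $E$-unification with simple variable restrictions is decidable.
   Context: $E$ is an equational theory in a functional signature $\mathcal{L}$ with at least one constant; $=_E$ is provable equality. (IT): whenever $f:\mathcal{A}\to\mathcal{B}$ is a homomorphism and $g:\mathcal{A}\to\mathcal{C}$ injective in $\mathbf{K}$, there exist a homomorphism $h:\mathcal{C}\to\mathcal{E}$ and an injective $h':\mathcal{B}\to\mathcal{E}$ with $h'f=hg$. Coherence: finitely generated subalgebras of finitely presented algebras are finitely presented. In the opposite $\mathsf{Alg}^{op}_{fp}(E)$ of the category of finitely presented $E$-algebras, $\mathsf{Sub}_r(V)$ is the poset of regular subobjects and $f^{ -1}$ is pullback; for $T\in\mathsf{Sub}_r(V\times W)$, a $\forall_V$-factorization is a finite list $B_1,\dots,B_n\in\mathsf{Sub}_r(W)$ with $\pi_W^{ -1}(B_i)\le T$ such that every $D\in\mathsf{Sub}_r(W)$ with $\pi_W^{ -1}(D)\le T$ is $\le$ some $B_i$; it is singular if $n=1$; the $\forall$-factorization property says every such $T$ has one. Unification: for a finite set $C$ of variables, a $C$-unification problem is a finite set of pairs $(\phi_i,\psi_i)$ of terms in variables $\overline p\supseteq C$;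 a $C$-unifier is a substitution $\sigma$ with $\sigma(c)=c$ for $c\in C$, $\sigma(q)$ free of variables of $C$ for $q\notin C$, and $\sigma(\phi_i)=_E\sigma(\psi_i)$ for all $i$; $\tau$ is less general than $\sigma$ if $\tau=_E\theta\circ\sigma$ for some substitution $\theta$; a $C$-unification basis is a set of $C$-unifiers such that every $C$-unifier is less general than a member; a most general $C$-unifier is one forming a singleton basis. $E$ has finitary (resp. unitary) simple-variable-restriction unification type if every $C$-unification problem has a finite basis (resp. a most general $C$-unifier); the case $C=\emptyset$ gives standard unifiers and finitary (unitary) unification type. Decidability of ($C$-)unification means it is decidable whether a given ($C$-)unification problem has a ($C$-)unifier. -}

module Defs where

open import Data.Nat using (ℕ)
open import Data.Fin using (Fin)
open import Data.List using (List; []; _∷_; length)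
open import Data.List.Membership.Propositional using (_∈_)
open import Data.List.Relation.Unary.All using (All)
open import Data.List.Relation.Unary.Any using (Any)
open import Data.Product using (Σ; ∃; _×_; _,_; proj₁; proj₂)
open import Data.Empty using (⊥)
open import Data.Sum using (_⊎_)
open import Relation.Nullary using (¬_; Dec)
open import Relation.Binary.PropositionalEquality using (_≡_)
open import Relation.Binary.Structures using (IsEquivalence)

record Signature : Set₁ where
  field
    Op    : Set
    arity : Op → ℕ

HasConstant : Signature → Set
HasConstant S = ∃ λ (o : Signature.Op S) → Signature.arity S o ≡ 0

module _ (S : Signature) where
  open Signature S

  data Term (X : Set) : Set where
    var  : X → Term X
    node : (o : Op) → (Fin (arity o) → Term X) → Term X

  subst : {X Y : Set} → (X → Term Y) → Term X → Term Y
  subst σ (var x)     = σ x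
  subst σ (node o ts) = node o (λ i → subst σ (ts i))

  data Occurs {X : Set} (x : X) : Term X → Set where
    here  : Occurs x (var x)
    there : ∀ o (ts : Fin (arity o) → Term X) (i : Fin (arity o)) →
            Occurs x (ts i) → Occurs x (node o ts)

record Theory (S : Signature) : Set₁ where
  field
    Ax  : Set
    lhs : Ax → Term S ℕ
    rhs : Ax → Term S ℕ

record Algebra (S : Signature) : Set₁ where
  open Signature S
  field
    Carrier : Set
    _≈_     : Carrier → Carrier → Set
    isEquiv : IsEquivalence _≈_
    ⟦_⟧     : (o : Op) → (Fin (arity o) → Carrier) → Carrier
    ⟦⟧-cong : ∀ o {xs ys : Fin (arity o) → Carrier} →
              (∀ i → xs i ≈ ys i) → ⟦ o ⟧ xs ≈ ⟦ o ⟧ ys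

module _ {S : Signature} (A : Algebra S) where
  open Algebra A

  eval : {X : Set} → (X → Carrier) → Term S X → Carrier
  eval ρ (var x)     = ρ x
  eval ρ (node o ts) = ⟦ o ⟧ (λ i → eval ρ (ts i))

module _ {S : Signature} where
  open Signature S

  record Hom (A B : Algebra S) : Set where
    private
      module A = Algebra A
      module B = Algebra B
    field
      fun  : A.Carrier → B.Carrier
      cong : ∀ {x y} → x A.≈ y → fun x B.≈ fun y
      pres : ∀ o (xs : Fin (arity o) → A.Carrier) →
             fun (A.⟦ o ⟧ xs) B.≈ B.⟦ o ⟧ (λ i → fun (xs i))
  open Hom public

  Injective : {A B : Algebra S} → Hom A B → Set
  Injective {A} {B} f =
    ∀ {x y} → Algebra._≈_ B (fun f x) (fun f y) → Algebra._≈_ A x y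

  _≈H_ : {A B : Algebra S} → Hom A B → Hom A B → Set
  _≈H_ {A} {B} f g = ∀ x → Algebra._≈_ B (fun f x) (fun g x)

  _∘H_ : {A B C : Algebra S} → Hom B C → Hom A B → Hom A C
  _∘H_ {A} {B} {C} g f = record
    { fun  = λ x → fun g (fun f x)
    ; cong = λ p → cong g (cong f p)
    ; pres = λ o xs → IsEquivalence.trans (Algebra.isEquiv C)
                        (cong g (pres f o xs)) (pres g o (λ i → fun f (xs i)))
    }

  Iso : Algebra S → Algebra S → Set
  Iso A B = Σ (Hom A B) λ f → Σ (Hom B A) λ g →
            (∀ x → Algebra._≈_ A (fun g (fun f x)) x) ×
            (∀ y → Algebra._≈_ B (fun f (fun g y)) y)

  -- the subalgebra of A generated by finitely many elements a₁..a_k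
  -- (presented as the image of the term algebra on k generators)
  Generated : (A : Algebra S) (k : ℕ) → (Fin k → Algebra.Carrier A) → Algebra S
  Generated A k a = record
    { Carrier = Term S (Fin k)
    ; _≈_     = λ u v → eval A a u ≈ eval A a v
    ; isEquiv = record { refl  = IsEquivalence.refl (Algebra.isEquiv A)
                       ; sym   = IsEquivalence.sym (Algebra.isEquiv A)
                       ; trans = IsEquivalence.trans (Algebra.isEquiv A) }
    ; ⟦_⟧     = node
    ; ⟦⟧-cong = λ o ps → Algebra.⟦⟧-cong A o ps
    }
    where open Algebra A using (_≈_)

module _ (S : Signature) (E : Theory S) where
  open Signature S
  open Theory E

  IsEAlgebra : Algebra S → Set
  IsEAlgebra A = ∀ (a : Ax) (ρ : ℕ → Algebra.Carrier A) →
                 Algebra._≈_ A (eval A ρ (lhs a)) (eval A ρ (rhs a))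

  record EAlgebra : Set₁ where
    field
      alg   : Algebra S
      model : IsEAlgebra alg
  open EAlgebra public

  data Derive {X : Set} (R : Term S X → Term S X → Set) :
              Term S X → Term S X → Set where
    rel   : ∀ {s t} → R s t → Derive R s t
    ax    : (a : Ax) (σ : ℕ → Term S X) →
            Derive R (subst S σ (lhs a)) (subst S σ (rhs a))
    drefl  : ∀ {s} → Derive R s s
    dsym   : ∀ {s t} → Derive R s t → Derive R t s
    dtrans : ∀ {s t u} → Derive R s t → Derive R t u → Derive R s u
    dcong  : ∀ o {us vs : Fin (arity o) → Term S X} →
            (∀ i → Derive R (us i) (vs i)) → Derive R (node o us) (node o vs)

  NoRel : {X : Set} → Term S X → Term S X → Set
  NoRel _ _ = ⊥

  _=E_ : Term S ℕ → Term S ℕ → Set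
  _=E_ = Derive NoRel

  record Presentation : Set where
    field
      gens : ℕ
      rels : List (Term S (Fin gens) × Term S (Fin gens))

  PresAlg : Presentation → Algebra S
  PresAlg P = record
    { Carrier = Term S (Fin gens)
    ; _≈_     = Derive R
    ; isEquiv = record { refl = drefl ; sym = dsym ; trans = dtrans }
    ; ⟦_⟧     = node
    ; ⟦⟧-cong = dcong
    }
    where
      open Presentation P
      R : Term S (Fin gens) → Term S (Fin gens) → Set
      R s t = (s , t) ∈ rels

  IsFinitelyPresented : Algebra S → Set
  IsFinitelyPresented A = Σ Presentation λ P → Iso (PresAlg P) A

  IT : Set₁
  IT = ∀ (A B C : EAlgebra) (f : Hom (alg A) (alg B)) (g : Hom (alg A) (alg C)) →
       Injective g →
       Σ EAlgebra λ D → Σ (Hom (alg C) (alg D)) λ h → Σ (Hom (alg B) (alg D)) λ h' →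
       Injective h' × (h' ∘H f) ≈H (h ∘H g)

  Coherent : Set
  Coherent = ∀ (P : Presentation) (k : ℕ)
               (a : Fin k → Algebra.Carrier (PresAlg P)) →
             IsFinitelyPresented (Generated (PresAlg P) k a)

  -- The category Alg^op_fp(E): objects are finite presentations (standing
  -- for the finitely presented E-algebras), a morphism V → W is a
  -- homomorphism PresAlg W → PresAlg V.

  Obj : Set
  Obj = Presentation

  _⇒_ : Obj → Obj → Set
  V ⇒ W = Hom (PresAlg W) (PresAlg V)

  _∘_ : {U V W : Obj} → V ⇒ W → U ⇒ V → U ⇒ W
  g ∘ f = f ∘H g

  _≈_ : {V W : Obj} → V ⇒ W → V ⇒ W → Set
  f ≈ g = f ≈H g

  IsEqualizer : {A V X : Obj} → A ⇒ V → V ⇒ X → V ⇒ X → Set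
  IsEqualizer {A} {V} m f g =
    (f ∘ m) ≈ (g ∘ m) ×
    (∀ (Z : Obj) (k : Z ⇒ V) → (f ∘ k) ≈ (g ∘ k) →
       Σ (Z ⇒ A) λ u → (m ∘ u) ≈ k × (∀ (u' : Z ⇒ A) → (m ∘ u') ≈ k → u' ≈ u))

  IsRegularMono : {A V : Obj} → A ⇒ V → Set
  IsRegularMono {A} {V} m = Σ Obj λ X → Σ (V ⇒ X) λ f → Σ (V ⇒ X) λ g →
                            IsEqualizer m f g

  Mono : Obj → Set
  Mono V = Σ Obj λ A → A ⇒ V

  RegSub : Obj → Set
  RegSub V = Σ (Mono V) λ m → IsRegularMono (proj₂ m)

  _≤_ : {V : Obj} → Mono V → Mono V → Set
  (A , m) ≤ (B , n) = Σ (A ⇒ B) λ k → (n ∘ k) ≈ m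

  IsProduct : {P V W : Obj} → P ⇒ V → P ⇒ W → Set
  IsProduct {P} {V} {W} πV πW =
    ∀ (Z : Obj) (f : Z ⇒ V) (g : Z ⇒ W) →
    Σ (Z ⇒ P) λ u → ((πV ∘ u) ≈ f × (πW ∘ u) ≈ g) ×
      (∀ (u' : Z ⇒ P) → (πV ∘ u') ≈ f → (πW ∘ u') ≈ g → u' ≈ u)

  IsPullback : {P W B Q : Obj} (f : P ⇒ W) (m : B ⇒ W) → Q ⇒ P → Q ⇒ B → Set
  IsPullback {P} {W} {B} {Q} f m m' f' =
    (f ∘ m') ≈ (m ∘ f') ×
    (∀ (Z : Obj) (x : Z ⇒ P) (y : Z ⇒ B) → (f ∘ x) ≈ (m ∘ y) →
       Σ (Z ⇒ Q) λ u → ((m' ∘ u) ≈ x × (f' ∘ u) ≈ y) ×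
         (∀ (u' : Z ⇒ Q) → (m' ∘ u') ≈ x → (f' ∘ u') ≈ y → u' ≈ u))

  -- f⁻¹(B) ≤ T   (f⁻¹(B) is the pullback of B along f)
  InvLe : {P W : Obj} (f : P ⇒ W) → RegSub W → RegSub P → Set
  InvLe {P} {W} f ((B , m) , _) (T , _) =
    ∀ (Q : Obj) (m' : Q ⇒ P) (f' : Q ⇒ B) → IsPullback f m m' f' → (Q , m') ≤ T

  -- a ∀_V-factorization of T ∈ Sub_r(V × W)  (V × W given by P, πV, πW)
  IsForallFactorization : {P V W : Obj} (πV : P ⇒ V) (πW : P ⇒ W) →
                          RegSub P → List (RegSub W) → Set
  IsForallFactorization {P} {V} {W} πV πW T Bs =
    All (λ B → InvLe πW B T) Bs ×
    (∀ (D : RegSub W) → InvLe πW D T → Any (λ B → proj₁ D ≤ proj₁ B) Bs)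

  ForallFactorizationProperty : Set
  ForallFactorizationProperty =
    ∀ (P V W : Obj) (πV : P ⇒ V) (πW : P ⇒ W) → IsProduct πV πW →
    ∀ (T : RegSub P) → Σ (List (RegSub W)) λ Bs → IsForallFactorization πV πW T Bs

  SingularForallFactorizationProperty : Set
  SingularForallFactorizationProperty =
    ∀ (P V W : Obj) (πV : P ⇒ V) (πW : P ⇒ W) → IsProduct πV πW →
    ∀ (T : RegSub P) → Σ (List (RegSub W)) λ Bs →
      length Bs ≡ 1 × IsForallFactorization πV πW T Bs

  record Problem : Set where
    field
      C   : List ℕ                        -- the restricted variables
      eqs : List (Term S ℕ × Term S ℕ)
  open Problem public

  Subst : Set
  Subst = ℕ → Term S ℕ

  ProblemVar : Problem → ℕ → Set
  ProblemVar P x = x ∈ C P ⊎ Any (λ e → Occurs S x (proj₁ e) ⊎ Occurs S x (proj₂ e)) (eqs P)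

  IsUnifier : Problem → Subst → Set
  IsUnifier P σ =
    (∀ c → c ∈ C P → σ c ≡ var c) ×
    (∀ q → ¬ (q ∈ C P) → ∀ c → c ∈ C P → ¬ Occurs S c (σ q)) ×
    All (λ e → subst S σ (proj₁ e) =E subst S σ (proj₂ e)) (eqs P)

  LessGeneral : Problem → Subst → Subst → Set
  LessGeneral P τ σ = Σ Subst λ θ → ∀ x → ProblemVar P x → τ x =E subst S θ (σ x)

  IsBasis : Problem → List Subst → Set
  IsBasis P L = All (IsUnifier P) L ×
                (∀ τ → IsUnifier P τ → Any (λ σ → LessGeneral P τ σ) L)

  IsMostGeneral : Problem → Subst → Set
  IsMostGeneral P σ = IsBasis P (σ ∷ [])

  Unifiable : Problem → Set
  Unifiable P = Σ Subst (IsUnifier P)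

  StdProblem : List (Term S ℕ × Term S ℕ) → Problem
  StdProblem es = record { C = [] ; eqs = es }

  FinitarySVR : Set
  FinitarySVR = ∀ (P : Problem) → Σ (List Subst) (IsBasis P)

  Finitary : Set
  Finitary = ∀ es → Σ (List Subst) (IsBasis (StdProblem es))

  UnitarySVR : Set
  UnitarySVR = ∀ (P : Problem) → Unifiable P → Σ Subst (IsMostGeneral P)

  Unitary : Set
  Unitary = ∀ es → Unifiable (StdProblem es) → Σ Subst (IsMostGeneral (StdProblem es))

  DecidableSVR : Set
  DecidableSVR = ∀ (P : Problem) → Dec (Unifiable P)

  Decidable : Set
  Decidable = ∀ es → Dec (Unifiable (StdProblem es))

-- Put the restricted variables C of a problem into a copy V and the other variables into a
-- copy W of the free algebra on N generators; the equations of the problem then present a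
-- regular subobject T of V × W in the opposite of the category of finitely presented algebras.
-- A member B of a ∀_V-factorization of T is an equalizer, i.e. the solution set of a standard
-- unification problem, and since π_W⁻¹(B) ≤ T, every standard unifier of it, with its values
-- shifted away from C, is a C-unifier. Conversely, by coherence a C-unifier τ has a finitely
-- presented kernel on W, and (IT) shows that the pullback of this kernel along π_W lies below T;
-- so the kernel lies below some B, whose problem τ therefore solves, and τ is less general than
-- the shift of any standard unifier it is less general than. Bases, most general unifiers and
-- decisions for the finitely many standard problems thus transfer to the restricted problem.

module Submission where

open import Defs hiding (_≈_; _∘_; _≤_; _⇒_; C; eqs)
import Defs as D
open import Data.Nat using (ℕ; suc; _+_; _∸_; _⊔_; _≤_; _<_; _<?_; s≤s; NonZero)
open import Data.Nat.Properties using (≤-refl; ≤-trans; m+n∸m≡n; m+n≮m; m≤m⊔n; m≤n⊔m)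
open import Data.Nat.DivMod using (_mod_; m<n⇒m%n≡m)
open import Data.Fin using (Fin; toℕ; _↑ˡ_; _↑ʳ_; splitAt; join)
open import Data.Fin.Properties using (toℕ-fromℕ<; join-splitAt)
open import Data.Vec.Functional using (_++_)
open import Data.Vec.Functional.Properties using (lookup-++ˡ; lookup-++ʳ)
open import Data.List using (List; []; _∷_; map; concatMap; length; lookup; allFin; upTo; tabulate)
  renaming (_++_ to _++ᴸ_)
open import Data.List.Properties using (length-map)
open import Data.List.Extrema.Nat using (max; v≤max⁺)
open import Data.List.Membership.Propositional using (_∈_; _∉_; find; lose)
open import Data.List.Membership.Propositional.Properties
  using (∈-map⁺; ∈-map⁻; ∈-++⁺ˡ; ∈-++⁺ʳ; ∈-++⁻; ∈-allFin; ∈-lookup; ∈-upTo⁺)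
open import Data.List.Membership.DecPropositional Data.Nat._≟_ using (_∈?_)
open import Data.List.Relation.Unary.All as All using (All; []; _∷_)
import Data.List.Relation.Unary.All.Properties as AllP
open import Data.List.Relation.Unary.Any as Any using (Any; here; there; any?)
import Data.List.Relation.Unary.Any.Properties as AnyP
open import Data.Product using (Σ; ∃; _×_; _,_; proj₁; proj₂)
import Data.Product as Product
open import Data.Sum using (_⊎_; inj₁; inj₂)
open import Function using (_∘_; _⇔_; mk⇔; Equivalence)
import Function.Properties.Equivalence as ⇔
open import Relation.Nullary using (¬_; Dec; yes; no; contradiction)
open import Level using (0ℓ)
open import Relation.Binary.Bundles using (Setoid)
import Relation.Binary.Reasoning.Setoid as SetoidReasoning
open import Relation.Binary.PropositionalEquality as Eq using (_≡_; refl)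
open import Relation.Binary.Structures using (IsEquivalence)

toℕ-mod : ∀ {x n} .{{_ : NonZero n}} → x < n → toℕ (x mod n) ≡ x
toℕ-mod x<n = Eq.trans (toℕ-fromℕ< _) (m<n⇒m%n≡m x<n)

↑-elim : ∀ m n {P : Fin (m + n) → Set} →
         (∀ j → P (j ↑ˡ n)) → (∀ j → P (m ↑ʳ j)) → ∀ i → P i
↑-elim m n {P} onLeft onRight i = Eq.subst P (join-splitAt m n i) (onSplit (splitAt m i))
  where
  onSplit : (s : Fin m ⊎ Fin n) → P (join m n s)
  onSplit (inj₁ j) = onLeft j
  onSplit (inj₂ j) = onRight j

maxᶠ : {n : ℕ} → (Fin n → ℕ) → ℕ
maxᶠ f = max 0 (tabulate f)

≤maxᶠ : {n : ℕ} (f : Fin n → ℕ) (i : Fin n) → f i ≤ maxᶠ f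
≤maxᶠ f i = v≤max⁺ 0 (tabulate f) (inj₂ (AnyP.tabulate⁺ i ≤-refl))

∈-map-elim : {A B : Set} {f : A → B} {xs : List A} (Q : B → Set) →
             (∀ {x} → x ∈ xs → Q (f x)) → ∀ {y} → y ∈ map f xs → Q y
∈-map-elim Q Q∘f = All.lookup (AllP.map⁺ {P = Q} (All.tabulate Q∘f))

length≡1⇒≡ : {A : Set} (xs : List A) → length xs ≡ 1 →
             ∀ {x y} → x ∈ xs → y ∈ xs → x ≡ y
length≡1⇒≡ (_ ∷ []) refl (here refl) (here refl) = refl

module Syntax (S : Signature) where

  infixl 8 _⟪_⟫
  _⟪_⟫ : {X Y : Set} → Term S X → (X → Term S Y) → Term S Y
  t ⟪ σ ⟫ = subst S σ t

  occurs-⟪⟫ : {X Y : Set} {y : Y} (t : Term S X) (σ : X → Term S Y) →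
              Occurs S y (t ⟪ σ ⟫) → ∃ λ x → Occurs S x t × Occurs S y (σ x)
  occurs-⟪⟫ (var x)     σ y∈σx = x , here , y∈σx
  occurs-⟪⟫ (node o ts) σ (there .o _ i oc) with occurs-⟪⟫ (ts i) σ oc
  ... | x , x∈tsᵢ , y∈σx = x , there o ts i x∈tsᵢ , y∈σx

  maxVar : Term S ℕ → ℕ
  maxVar (var x)     = x
  maxVar (node o ts) = maxᶠ (λ i → maxVar (ts i))

  occurs⇒≤maxVar : ∀ {x} (t : Term S ℕ) → Occurs S x t → x ≤ maxVar t
  occurs⇒≤maxVar (var x)     here              = ≤-refl
  occurs⇒≤maxVar (node o ts) (there .o .ts i oc) =
    ≤-trans (occurs⇒≤maxVar (ts i) oc) (≤maxᶠ _ i)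

  varBound : {n : ℕ} → (Fin n → Term S ℕ) → ℕ
  varBound σ = suc (maxᶠ (maxVar ∘ σ))

  occurs⇒<varBound : ∀ {n y} (σ : Fin n → Term S ℕ) (q : Fin n) →
                     Occurs S y (σ q) → y < varBound σ
  occurs⇒<varBound σ q oc =
    s≤s (≤-trans (occurs⇒≤maxVar (σ q) oc) (≤maxᶠ (maxVar ∘ σ) q))

module AlgebraReasoning {S : Signature} (A : Algebra S) where
  open Algebra A public
  open IsEquivalence isEquiv public
    using (reflexive) renaming (refl to ≈-refl; sym to ≈-sym; trans to ≈-trans)

  setoid : Setoid 0ℓ 0ℓ
  setoid = record { isEquivalence = isEquiv }

  open SetoidReasoning setoid public

module Equational (S : Signature) (E : Theory S) where
  open Theory E
  open Syntax S

  Rel : Set → Set₁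
  Rel X = Term S X → Term S X → Set

  listRel : {X : Set} → List (Term S X × Term S X) → Rel X
  listRel L s t = (s , t) ∈ L

  infix 4 _⊢_≐_ _≐_
  _⊢_≐_ : {X : Set} → Rel X → Term S X → Term S X → Set
  R ⊢ s ≐ t = Derive S E R s t

  _≐_ : {X : Set} → Term S X → Term S X → Set
  s ≐ t = NoRel S E ⊢ s ≐ t

  Derive-map : {X : Set} {R R′ : Rel X} → (∀ {s t} → R s t → R′ s t) →
               ∀ {s t} → R ⊢ s ≐ t → R′ ⊢ s ≐ t
  Derive-map h (rel r)       = rel (h r)
  Derive-map h (ax a σ)      = ax a σ
  Derive-map h drefl         = drefl
  Derive-map h (dsym d)      = dsym (Derive-map h d)
  Derive-map h (dtrans d d′) = dtrans (Derive-map h d) (Derive-map h d′)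
  Derive-map h (dcong o ds)  = dcong o (λ i → Derive-map h (ds i))

  TermAlg : (X : Set) → Rel X → Algebra S
  TermAlg X R = record
    { Carrier = Term S X
    ; _≈_     = R ⊢_≐_
    ; isEquiv = record { refl = drefl ; sym = dsym ; trans = dtrans }
    ; ⟦_⟧     = node
    ; ⟦⟧-cong = dcong
    }

  TermE : Algebra S
  TermE = TermAlg ℕ (NoRel S E)

  module _ {X Y : Set} {R : Rel Y} where
    ⟪⟫-∘ : {Z : Set} (t : Term S Z) (ρ : Z → Term S X) (σ : X → Term S Y) →
           R ⊢ t ⟪ ρ ⟫ ⟪ σ ⟫ ≐ t ⟪ (λ z → ρ z ⟪ σ ⟫) ⟫
    ⟪⟫-∘ (var z)     ρ σ = drefl
    ⟪⟫-∘ (node o ts) ρ σ = dcong o (λ i → ⟪⟫-∘ (ts i) ρ σ)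

    ⟪⟫-cong-occurs : (t : Term S X) (σ τ : X → Term S Y) →
                     (∀ x → Occurs S x t → R ⊢ σ x ≐ τ x) → R ⊢ t ⟪ σ ⟫ ≐ t ⟪ τ ⟫
    ⟪⟫-cong-occurs (var x)     σ τ σ≐τ = σ≐τ x here
    ⟪⟫-cong-occurs (node o ts) σ τ σ≐τ =
      dcong o (λ i → ⟪⟫-cong-occurs (ts i) σ τ (λ x oc → σ≐τ x (there o ts i oc)))

    eval-TermAlg : (σ : X → Term S Y) (t : Term S X) → R ⊢ eval (TermAlg Y R) σ t ≐ t ⟪ σ ⟫
    eval-TermAlg σ (var x)     = drefl
    eval-TermAlg σ (node o ts) = dcong o (λ i → eval-TermAlg σ (ts i))

  ⟪var⟫ : {X : Set} {R : Rel X} (t : Term S X) → R ⊢ t ⟪ var ⟫ ≐ t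
  ⟪var⟫ (var x)     = drefl
  ⟪var⟫ (node o ts) = dcong o (λ i → ⟪var⟫ (ts i))

  ⟪⟫-Derive : {X Y : Set} {R : Rel X} {R′ : Rel Y} (σ : X → Term S Y) →
              (∀ {s t} → R s t → R′ ⊢ s ⟪ σ ⟫ ≐ t ⟪ σ ⟫) →
              ∀ {s t} → R ⊢ s ≐ t → R′ ⊢ s ⟪ σ ⟫ ≐ t ⟪ σ ⟫
  ⟪⟫-Derive σ h (rel r)       = h r
  ⟪⟫-Derive σ h (ax a ρ)      =
    dtrans (⟪⟫-∘ (lhs a) ρ σ) (dtrans (ax a _) (dsym (⟪⟫-∘ (rhs a) ρ σ)))
  ⟪⟫-Derive σ h drefl         = drefl
  ⟪⟫-Derive σ h (dsym d)      = dsym (⟪⟫-Derive σ h d)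
  ⟪⟫-Derive σ h (dtrans d d′) = dtrans (⟪⟫-Derive σ h d) (⟪⟫-Derive σ h d′)
  ⟪⟫-Derive σ h (dcong o ds)  = dcong o (λ i → ⟪⟫-Derive σ h (ds i))

  ⟪⟫-≐ : {X Y : Set} (σ : X → Term S Y) {s t : Term S X} → s ≐ t → s ⟪ σ ⟫ ≐ t ⟪ σ ⟫
  ⟪⟫-≐ σ = ⟪⟫-Derive σ (λ ())

  module _ (A : Algebra S) where
    open AlgebraReasoning A

    eval-⟪⟫ : {X Y : Set} (ρ : Y → Carrier) (σ : X → Term S Y) (t : Term S X) →
              eval A ρ (t ⟪ σ ⟫) ≈ eval A (λ x → eval A ρ (σ x)) t
    eval-⟪⟫ ρ σ (var x)     = ≈-refl
    eval-⟪⟫ ρ σ (node o ts) = ⟦⟧-cong o (λ i → eval-⟪⟫ ρ σ (ts i))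

    eval-cong-occurs : {X : Set} (ρ ρ′ : X → Carrier) (t : Term S X) →
                       (∀ x → Occurs S x t → ρ x ≈ ρ′ x) → eval A ρ t ≈ eval A ρ′ t
    eval-cong-occurs ρ ρ′ (var x)     ρ≈ρ′ = ρ≈ρ′ x here
    eval-cong-occurs ρ ρ′ (node o ts) ρ≈ρ′ =
      ⟦⟧-cong o (λ i → eval-cong-occurs ρ ρ′ (ts i) (λ x oc → ρ≈ρ′ x (there o ts i oc)))

    eval-Derive : IsEAlgebra S E A → {X : Set} {R : Rel X} (ρ : X → Carrier) →
                  (∀ {s t} → R s t → eval A ρ s ≈ eval A ρ t) →
                  ∀ {s t} → R ⊢ s ≐ t → eval A ρ s ≈ eval A ρ t
    eval-Derive isE ρ h (rel r)       = h r
    eval-Derive isE ρ h (ax a σ)      = begin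
      eval A ρ (lhs a ⟪ σ ⟫)                   ≈⟨ eval-⟪⟫ ρ σ (lhs a) ⟩
      eval A (λ x → eval A ρ (σ x)) (lhs a)    ≈⟨ isE a _ ⟩
      eval A (λ x → eval A ρ (σ x)) (rhs a)    ≈⟨ eval-⟪⟫ ρ σ (rhs a) ⟨
      eval A ρ (rhs a ⟪ σ ⟫)                   ∎
    eval-Derive isE ρ h drefl         = ≈-refl
    eval-Derive isE ρ h (dsym d)      = ≈-sym (eval-Derive isE ρ h d)
    eval-Derive isE ρ h (dtrans d d′) = ≈-trans (eval-Derive isE ρ h d) (eval-Derive isE ρ h d′)
    eval-Derive isE ρ h (dcong o ds)  = ⟦⟧-cong o (λ i → eval-Derive isE ρ h (ds i))

    evalHom : IsEAlgebra S E A → {X : Set} {R : Rel X} (ρ : X → Carrier) →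
              (∀ {s t} → R s t → eval A ρ s ≈ eval A ρ t) → Hom (TermAlg X R) A
    evalHom isE ρ h = record
      { fun = eval A ρ ; cong = eval-Derive isE ρ h ; pres = λ o xs → ≈-refl }

    module _ {X : Set} {R : Rel X} (h : Hom (TermAlg X R) A) where
      hom-eval : (t : Term S X) → fun h t ≈ eval A (λ x → fun h (var x)) t
      hom-eval (var x)     = ≈-refl
      hom-eval (node o ts) = ≈-trans (pres h o ts) (⟦⟧-cong o (λ i → hom-eval (ts i)))

      hom-⟪⟫ : {Y : Set} (σ : Y → Term S X) (t : Term S Y) →
               fun h (t ⟪ σ ⟫) ≈ eval A (λ y → fun h (σ y)) t
      hom-⟪⟫ σ t = begin
        fun h (t ⟪ σ ⟫)                                      ≈⟨ hom-eval (t ⟪ σ ⟫) ⟩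
        eval A (λ x → fun h (var x)) (t ⟪ σ ⟫)               ≈⟨ eval-⟪⟫ _ σ t ⟩
        eval A (λ y → eval A (λ x → fun h (var x)) (σ y)) t  ≈⟨ eval-cong-occurs _ _ t
                                                                  (λ y _ → ≈-sym (hom-eval (σ y))) ⟩
        eval A (λ y → fun h (σ y)) t                         ∎

    hom-ext : {X : Set} {R : Rel X} (h₁ h₂ : Hom (TermAlg X R) A) →
              (∀ x → fun h₁ (var x) ≈ fun h₂ (var x)) → _≈H_ {A = TermAlg X R} {A} h₁ h₂
    hom-ext h₁ h₂ h₁≈h₂ t = begin
      fun h₁ t                             ≈⟨ hom-eval h₁ t ⟩
      eval A (λ x → fun h₁ (var x)) t      ≈⟨ eval-cong-occurs _ _ t (λ x _ → h₁≈h₂ x) ⟩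
      eval A (λ x → fun h₂ (var x)) t      ≈⟨ hom-eval h₂ t ⟨
      fun h₂ t                             ∎

  TermAlg-isEAlgebra : {X : Set} {R : Rel X} → IsEAlgebra S E (TermAlg X R)
  TermAlg-isEAlgebra a ρ =
    dtrans (eval-TermAlg ρ (lhs a)) (dtrans (ax a ρ) (dsym (eval-TermAlg ρ (rhs a))))

module Presentations (S : Signature) (E : Theory S) where
  open Syntax S
  open Equational S E

  Pres : Set
  Pres = Presentation S E

  Alg : Pres → Algebra S
  Alg = PresAlg S E

  infix 4 _⇒_ _⊑_
  _⇒_ : Pres → Pres → Set
  _⇒_ = D._⇒_ S E

  _⊑_ : {V : Pres} → Mono S E V → Mono S E V → Set
  _⊑_ = D._≤_ S E

  ⟨_∣_⟩ : (n : ℕ) → List (Term S (Fin n) × Term S (Fin n)) → Pres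
  ⟨ n ∣ L ⟩ = record { gens = n ; rels = L }

  Free : ℕ → Pres
  Free n = ⟨ n ∣ [] ⟩

  Alg-isEAlgebra : (P : Pres) → IsEAlgebra S E (Alg P)
  Alg-isEAlgebra P = TermAlg-isEAlgebra

  freeHom : {n : ℕ} (A : Algebra S) → IsEAlgebra S E A →
            (Fin n → Algebra.Carrier A) → Hom (Alg (Free n)) A
  freeHom A isE ρ = evalHom A isE ρ (λ ())

  factorHom : {X : Set} {R R′ : Rel X} (A : Algebra S) (k : Hom (TermAlg X R) A) →
              (∀ {s t} → R′ s t → Algebra._≈_ A (fun k s) (fun k t)) → Hom (TermAlg X R′) A
  factorHom {R′ = R′} A k k-resp = record { fun = fun k ; cong = resp ; pres = pres k }
    where
    open AlgebraReasoning A
    resp : ∀ {s t} → R′ ⊢ s ≐ t → fun k s ≈ fun k t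
    resp (rel r)       = k-resp r
    resp (ax a σ)      = cong k (ax a σ)
    resp drefl         = ≈-refl
    resp (dsym d)      = ≈-sym (resp d)
    resp (dtrans d d′) = ≈-trans (resp d) (resp d′)
    resp (dcong o {us} {vs} ds) = begin
      fun k (node o us)            ≈⟨ pres k o us ⟩
      ⟦ o ⟧ (λ i → fun k (us i))   ≈⟨ ⟦⟧-cong o (λ i → resp (ds i)) ⟩
      ⟦ o ⟧ (λ i → fun k (vs i))   ≈⟨ pres k o vs ⟨
      fun k (node o vs)            ∎

  quotientHom : (n : ℕ) (L : List (Term S (Fin n) × Term S (Fin n))) → ⟨ n ∣ L ⟩ ⇒ Free n
  quotientHom n L = record { fun = λ t → t ; cong = Derive-map (λ ()) ; pres = λ o xs → drefl }

  quotientHom-isRegularMono : (n : ℕ) (L : List (Term S (Fin n) × Term S (Fin n))) →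
                              IsRegularMono S E (quotientHom n L)
  quotientHom-isRegularMono n L = Free (length L) , lefts , rights , equalizes , universal
    where
    pair : Fin (length L) → Term S (Fin n) × Term S (Fin n)
    pair = lookup L
    lefts rights : Free n ⇒ Free (length L)
    lefts  = freeHom (Alg (Free n)) (Alg-isEAlgebra _) (proj₁ ∘ pair)
    rights = freeHom (Alg (Free n)) (Alg-isEAlgebra _) (proj₂ ∘ pair)
    equalizes : _≈H_ {A = Alg (Free (length L))} {Alg ⟨ n ∣ L ⟩}
                     (quotientHom n L ∘H lefts) (quotientHom n L ∘H rights)
    equalizes = hom-ext (Alg ⟨ n ∣ L ⟩) (quotientHom n L ∘H lefts) (quotientHom n L ∘H rights)
                        (λ j → rel (∈-lookup j))
    universal : (Z : Pres) (k : Z ⇒ Free n) → (k ∘H lefts) ≈H (k ∘H rights) →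
                Σ (Z ⇒ ⟨ n ∣ L ⟩) λ u → (u ∘H quotientHom n L) ≈H k ×
                  (∀ u′ → (u′ ∘H quotientHom n L) ≈H k → u′ ≈H u)
    universal Z k k∘lefts≈k∘rights =
      factorHom (Alg Z) k k-resp , (λ _ → drefl) , (λ u′ u′∘q≈k x → u′∘q≈k x)
      where
      k-resp : ∀ {s t} → (s , t) ∈ L → Algebra._≈_ (Alg Z) (fun k s) (fun k t)
      k-resp {s} {t} st∈L =
        Eq.subst (λ e → Algebra._≈_ (Alg Z) (fun k (proj₁ e)) (fun k (proj₂ e)))
                 (Eq.sym (AnyP.lookup-index st∈L)) (k∘lefts≈k∘rights (var (Any.index st∈L)))

  π₁ : (m n : ℕ) → Free (m + n) ⇒ Free m
  π₁ m n = freeHom (Alg (Free (m + n))) (Alg-isEAlgebra _) (λ j → var (j ↑ˡ n))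

  π₂ : (m n : ℕ) → Free (m + n) ⇒ Free n
  π₂ m n = freeHom (Alg (Free (m + n))) (Alg-isEAlgebra _) (λ j → var (m ↑ʳ j))

  free-isProduct : (m n : ℕ) → IsProduct S E (π₁ m n) (π₂ m n)
  free-isProduct m n Z f g = pairing , (π₁-pairing , π₂-pairing) , unique
    where
    open AlgebraReasoning (Alg Z)
    pairing : Z ⇒ Free (m + n)
    pairing = freeHom (Alg Z) (Alg-isEAlgebra Z) ((fun f ∘ var) ++ (fun g ∘ var))
    π₁-pairing : (pairing ∘H π₁ m n) ≈H f
    π₁-pairing = hom-ext (Alg Z) (pairing ∘H π₁ m n) f
                   (λ j → reflexive (lookup-++ˡ (fun f ∘ var) (fun g ∘ var) j))
    π₂-pairing : (pairing ∘H π₂ m n) ≈H g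
    π₂-pairing = hom-ext (Alg Z) (pairing ∘H π₂ m n) g
                   (λ j → reflexive (lookup-++ʳ (fun f ∘ var) (fun g ∘ var) j))
    unique : ∀ u → (u ∘H π₁ m n) ≈H f → (u ∘H π₂ m n) ≈H g → u ≈H pairing
    unique u u∘π₁≈f u∘π₂≈g = hom-ext (Alg Z) u pairing (↑-elim m n
      (λ j → ≈-trans (u∘π₁≈f (var j)) (≈-sym (π₁-pairing (var j))))
      (λ j → ≈-trans (u∘π₂≈g (var j)) (≈-sym (π₂-pairing (var j)))))

  module π₂-Pullback (m : ℕ) {n : ℕ} (B : Pres) (mB : B ⇒ Free n) where
    gensB : ℕ
    gensB = Presentation.gens B

    liftTerm : Term S (Fin gensB) → Term S (Fin (m + gensB))
    liftTerm t = t ⟪ var ∘ (m ↑ʳ_) ⟫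

    Pullback : Pres
    Pullback = ⟨ m + gensB ∣ map (Product.map liftTerm liftTerm) (Presentation.rels B) ⟩

    liftTerm-rel : ∀ {s t} → (s , t) ∈ Presentation.rels B →
                   listRel (Presentation.rels Pullback) ⊢ liftTerm s ≐ liftTerm t
    liftTerm-rel st∈B = rel (∈-map⁺ (Product.map liftTerm liftTerm) st∈B)

    m′ : Pullback ⇒ Free (m + n)
    m′ = freeHom (Alg Pullback) (Alg-isEAlgebra _)
                 ((var ∘ (_↑ˡ gensB)) ++ (liftTerm ∘ fun mB ∘ var))

    m′-↑ˡ : ∀ j → fun m′ (var (j ↑ˡ n)) ≡ var (j ↑ˡ gensB)
    m′-↑ˡ = lookup-++ˡ (var ∘ (_↑ˡ gensB)) (liftTerm ∘ fun mB ∘ var)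

    m′-↑ʳ : ∀ q → fun m′ (var (m ↑ʳ q)) ≡ liftTerm (fun mB (var q))
    m′-↑ʳ = lookup-++ʳ (var ∘ (_↑ˡ gensB)) (liftTerm ∘ fun mB ∘ var)

    f′ : Pullback ⇒ B
    f′ = evalHom (Alg Pullback) (Alg-isEAlgebra _) (var ∘ (m ↑ʳ_)) λ {s} {t} st∈B →
           dtrans (eval-TermAlg _ s) (dtrans (liftTerm-rel st∈B) (dsym (eval-TermAlg _ t)))

    module Copair (A : Algebra S) (isE : IsEAlgebra S E A)
                  (left : Fin m → Algebra.Carrier A) (k : Hom (Alg B) A) where
      open AlgebraReasoning A

      private
        ρ : Fin (m + gensB) → Carrier
        ρ = left ++ (fun k ∘ var)

        eval-liftTerm : ∀ t → eval A ρ (liftTerm t) ≈ fun k t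
        eval-liftTerm t = begin
          eval A ρ (liftTerm t)                      ≈⟨ eval-⟪⟫ A ρ _ t ⟩
          eval A (λ c → ρ (m ↑ʳ c)) t                ≈⟨ eval-cong-occurs A _ _ t
                                                          (λ c _ → reflexive (lookup-++ʳ left _ c)) ⟩
          eval A (λ c → fun k (var c)) t             ≈⟨ hom-eval A k t ⟨
          fun k t                                    ∎

      copair : Hom (Alg Pullback) A
      copair = evalHom A isE ρ resp
        where
        resp : ∀ {s t} → (s , t) ∈ Presentation.rels Pullback → eval A ρ s ≈ eval A ρ t
        resp st∈P with ∈-map⁻ (Product.map liftTerm liftTerm) st∈P
        ... | (s , t) , st∈B , refl = begin
          eval A ρ (liftTerm s)   ≈⟨ eval-liftTerm s ⟩
          fun k s                 ≈⟨ cong k (rel st∈B) ⟩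
          fun k t                 ≈⟨ eval-liftTerm t ⟨
          eval A ρ (liftTerm t)   ∎

      copair-↑ˡ : ∀ j → fun copair (var (j ↑ˡ gensB)) ≈ left j
      copair-↑ˡ j = reflexive (lookup-++ˡ left _ j)

      copair-liftTerm : ∀ t → fun copair (liftTerm t) ≈ fun k t
      copair-liftTerm = eval-liftTerm

    isPullback : IsPullback S E (π₂ m n) mB m′ f′
    isPullback = commutes , universal
      where
      commutes : (m′ ∘H π₂ m n) ≈H (f′ ∘H mB)
      commutes = hom-ext (Alg Pullback) (m′ ∘H π₂ m n) (f′ ∘H mB) λ q →
        dtrans (Eq.subst (listRel _ ⊢ fun m′ (var (m ↑ʳ q)) ≐_) (m′-↑ʳ q) drefl)
               (dsym (eval-TermAlg _ (fun mB (var q))))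

      universal : (Z : Pres) (x : Z ⇒ Free (m + n)) (y : Z ⇒ B) → (x ∘H π₂ m n) ≈H (y ∘H mB) →
                  Σ (Z ⇒ Pullback) λ u → ((u ∘H m′) ≈H x × (u ∘H f′) ≈H y) ×
                    (∀ u′ → (u′ ∘H m′) ≈H x → (u′ ∘H f′) ≈H y → u′ ≈H u)
      universal Z x y x∘π₂≈y∘mB = u , (u∘m′≈x , u∘f′≈y) , unique
        where
        open AlgebraReasoning (Alg Z)
        open Copair (Alg Z) (Alg-isEAlgebra Z) (λ j → fun x (var (j ↑ˡ n))) y
        u : Z ⇒ Pullback
        u = copair

        u∘m′≈x : (u ∘H m′) ≈H x
        u∘m′≈x = hom-ext (Alg Z) (u ∘H m′) x (↑-elim m n
          (λ j → begin
            fun u (fun m′ (var (j ↑ˡ n)))       ≡⟨ Eq.cong (fun u) (m′-↑ˡ j) ⟩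
            fun u (var (j ↑ˡ gensB))            ≈⟨ copair-↑ˡ j ⟩
            fun x (var (j ↑ˡ n))                ∎)
          (λ q → begin
            fun u (fun m′ (var (m ↑ʳ q)))       ≡⟨ Eq.cong (fun u) (m′-↑ʳ q) ⟩
            fun u (liftTerm (fun mB (var q)))   ≈⟨ copair-liftTerm _ ⟩
            fun y (fun mB (var q))              ≈⟨ x∘π₂≈y∘mB (var q) ⟨
            fun x (var (m ↑ʳ q))                ∎))

        u∘f′≈y : (u ∘H f′) ≈H y
        u∘f′≈y = hom-ext (Alg Z) (u ∘H f′) y (λ c → copair-liftTerm (var c))

        unique : ∀ u′ → (u′ ∘H m′) ≈H x → (u′ ∘H f′) ≈H y → u′ ≈H u
        unique u′ u′∘m′≈x u′∘f′≈y = hom-ext (Alg Z) u′ u (↑-elim m gensB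
          (λ j → begin
            fun u′ (var (j ↑ˡ gensB))         ≡⟨ Eq.cong (fun u′) (m′-↑ˡ j) ⟨
            fun u′ (fun m′ (var (j ↑ˡ n)))    ≈⟨ u′∘m′≈x (var (j ↑ˡ n)) ⟩
            fun x (var (j ↑ˡ n))              ≈⟨ copair-↑ˡ j ⟨
            fun u (var (j ↑ˡ gensB))          ∎)
          (λ c → ≈-trans (u′∘f′≈y (var c)) (≈-sym (u∘f′≈y (var c)))))

  module RegularSubobject {n : ℕ} (B : RegSub S E (Free n)) where
    carrier : Pres
    carrier = proj₁ (proj₁ B)

    inclusion : carrier ⇒ Free n
    inclusion = proj₂ (proj₁ B)

    private
      X : Pres
      X = proj₁ (proj₂ B)
      f g : Free n ⇒ X
      f = proj₁ (proj₂ (proj₂ B))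
      g = proj₁ (proj₂ (proj₂ (proj₂ B)))
      equalizer : IsEqualizer S E inclusion f g
      equalizer = proj₂ (proj₂ (proj₂ (proj₂ B)))

    definingPairs : List (Term S (Fin n) × Term S (Fin n))
    definingPairs = map (λ j → fun f (var j) , fun g (var j)) (allFin (Presentation.gens X))

    quotient⊑ : (⟨ n ∣ definingPairs ⟩ , quotientHom n definingPairs) ⊑ proj₁ B
    quotient⊑ = Product.map₂ proj₁ (proj₂ equalizer _ (quotientHom n definingPairs) coequalizes)
      where
      coequalizes : (quotientHom n definingPairs ∘H f) ≈H (quotientHom n definingPairs ∘H g)
      coequalizes = hom-ext (Alg ⟨ n ∣ definingPairs ⟩)
        (quotientHom n definingPairs ∘H f) (quotientHom n definingPairs ∘H g)
        (λ j → rel (∈-map⁺ _ (∈-allFin j)))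

    definingPairs-hold : (D : Mono S E (Free n)) → D ⊑ proj₁ B →
                         ∀ {s t} → (s , t) ∈ definingPairs →
                         Algebra._≈_ (Alg (proj₁ D)) (fun (proj₂ D) s) (fun (proj₂ D) t)
    definingPairs-hold (Do , mD) (k , k∘inclusion≈mD) st∈pairs
      with ∈-map⁻ _ st∈pairs
    ... | j , _ , refl = begin
      fun mD (fun f (var j))                 ≈⟨ k∘inclusion≈mD _ ⟨
      fun k (fun inclusion (fun f (var j)))  ≈⟨ cong k (proj₁ equalizer (var j)) ⟩
      fun k (fun inclusion (fun g (var j)))  ≈⟨ k∘inclusion≈mD _ ⟩
      fun mD (fun g (var j))                 ∎
      where open AlgebraReasoning (Alg Do)

module StandardUnification (S : Signature) (E : Theory S) where
  open Syntax S
  open Equational S E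
  open Presentations S E

  Equations : Set
  Equations = List (Term S ℕ × Term S ℕ)

  IsStdUnifier : Equations → Subst S E → Set
  IsStdUnifier es = IsUnifier S E (StdProblem S E es)

  stdUnifier : ∀ {es σ} → (∀ {φ ψ} → (φ , ψ) ∈ es → φ ⟪ σ ⟫ ≐ ψ ⟪ σ ⟫) →
               IsStdUnifier es σ
  stdUnifier unifies = (λ _ ()) , (λ _ _ _ ()) , All.tabulate unifies

  stdUnifier-unifies : ∀ {es σ} → IsStdUnifier es σ →
                       ∀ {φ ψ} → (φ , ψ) ∈ es → φ ⟪ σ ⟫ ≐ ψ ⟪ σ ⟫
  stdUnifier-unifies (_ , _ , unifies) = All.lookup unifies

  stdUnifier-instance : ∀ {es σ} (θ : Subst S E) → IsStdUnifier es σ →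
                        IsStdUnifier es (λ x → σ x ⟪ θ ⟫)
  stdUnifier-instance {σ = σ} θ σ-unifies = stdUnifier λ {φ} {ψ} e∈es →
    dtrans (dsym (⟪⟫-∘ φ σ θ))
      (dtrans (⟪⟫-≐ θ (stdUnifier-unifies σ-unifies e∈es)) (⟪⟫-∘ ψ σ θ))

  module SubobjectEquations {n : ℕ} (B : RegSub S E (Free n)) where
    open RegularSubobject B

    toℕTerm : Term S (Fin n) → Term S ℕ
    toℕTerm t = t ⟪ var ∘ toℕ ⟫

    -- The trivial equations x = x (x < n) make every x < n a variable of the problem,
    -- so that being less general constrains all of them.
    equations : Equations
    equations = map (Product.map toℕTerm toℕTerm) definingPairs
                ++ᴸ map (λ x → var x , var x) (upTo n)

    equations-var : ∀ {x} → x < n → ProblemVar S E (StdProblem S E equations) x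
    equations-var x<n =
      inj₂ (AnyP.++⁺ʳ _ (AnyP.map⁺ (Any.map (λ { refl → inj₁ here }) (∈-upTo⁺ x<n))))

    unifier-unifies-pairs : ∀ {ρ} → IsStdUnifier equations ρ → ∀ {s t} → (s , t) ∈ definingPairs →
                            s ⟪ ρ ∘ toℕ ⟫ ≐ t ⟪ ρ ∘ toℕ ⟫
    unifier-unifies-pairs {ρ} ρ-unifies {s} {t} st∈pairs =
      dtrans (dsym (⟪⟫-∘ s (var ∘ toℕ) ρ))
        (dtrans (stdUnifier-unifies ρ-unifies (∈-++⁺ˡ (∈-map⁺ _ st∈pairs)))
          (⟪⟫-∘ t (var ∘ toℕ) ρ))

    unifies-pairs⇒unifier : ∀ {τ} →
                            (∀ {s t} → (s , t) ∈ definingPairs → s ⟪ τ ∘ toℕ ⟫ ≐ t ⟪ τ ∘ toℕ ⟫) →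
                            IsStdUnifier equations τ
    unifies-pairs⇒unifier {τ} unifies = stdUnifier unifies-equation
      where
      unifies-equation : ∀ {φ ψ} → (φ , ψ) ∈ equations → φ ⟪ τ ⟫ ≐ ψ ⟪ τ ⟫
      unifies-equation e∈ with ∈-++⁻ _ e∈
      ... | inj₂ e∈trivial with ∈-map⁻ (λ x → var x , var x) e∈trivial
      ...   | _ , _ , refl = drefl
      unifies-equation e∈ | inj₁ e∈pairs with ∈-map⁻ (Product.map toℕTerm toℕTerm) e∈pairs
      ...   | (s , t) , st∈pairs , refl =
        dtrans (⟪⟫-∘ s (var ∘ toℕ) τ)
          (dtrans (unifies st∈pairs) (dsym (⟪⟫-∘ t (var ∘ toℕ) τ)))

    unifierHom : ∀ {ρ} → IsStdUnifier equations ρ → Hom (Alg ⟨ n ∣ definingPairs ⟩) TermE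
    unifierHom {ρ} ρ-unifies = record
      { fun  = _⟪ ρ ∘ toℕ ⟫
      ; cong = ⟪⟫-Derive _ (unifier-unifies-pairs ρ-unifies)
      ; pres = λ _ _ → drefl
      }

module Kernels (S : Signature) (E : Theory S) (coherent : Coherent S E) where
  open Syntax S
  open Equational S E
  open Presentations S E

  PresentsKernel : {n : ℕ} {Y : Set} → (Fin n → Term S Y) →
                   List (Term S (Fin n) × Term S (Fin n)) → Set
  PresentsKernel σ L = ∀ {u v} → (listRel L ⊢ u ≐ v) ⇔ (u ⟪ σ ⟫ ≐ v ⟪ σ ⟫)

  -- Coherence presents the subalgebra generated by a as P′; the kernel is generated by the
  -- relations of P′ transported along F, together with an expression of each generator q in P′.
  finiteKernelᶠ : (n k : ℕ) (a : Fin n → Term S (Fin k)) → ∃ (PresentsKernel a)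
  finiteKernelᶠ n k a = L , mk⇔ sound complete
    where
    Gen : Algebra S
    Gen = Generated (Alg (Free k)) n a
    module Gen = AlgebraReasoning Gen

    P′ : Pres
    P′ = proj₁ (coherent (Free k) n a)
    F : Hom (Alg P′) Gen
    F = proj₁ (proj₂ (coherent (Free k) n a))
    G : Hom Gen (Alg P′)
    G = proj₁ (proj₂ (proj₂ (coherent (Free k) n a)))
    F∘G≈id : ∀ u → fun F (fun G u) Gen.≈ u
    F∘G≈id = proj₂ (proj₂ (proj₂ (proj₂ (coherent (Free k) n a))))

    Φ : Term S (Fin (Presentation.gens P′)) → Term S (Fin n)
    Φ t = t ⟪ fun F ∘ var ⟫

    L : List (Term S (Fin n) × Term S (Fin n))
    L = map (λ q → var q , Φ (fun G (var q))) (allFin n)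
        ++ᴸ map (Product.map Φ Φ) (Presentation.rels P′)

    Gen≈⇔≐ : ∀ {u v} → (u Gen.≈ v) ⇔ (u ⟪ a ⟫ ≐ v ⟪ a ⟫)
    Gen≈⇔≐ {u} {v} = mk⇔
      (λ u≈v → Derive-map (λ ()) (dtrans (dsym (eval-TermAlg a u)) (dtrans u≈v (eval-TermAlg a v))))
      (λ u≐v → dtrans (eval-TermAlg a u) (dtrans (Derive-map (λ ()) u≐v) (dsym (eval-TermAlg a v))))

    eval-Gen : {Y : Set} (σ : Y → Term S (Fin n)) (t : Term S Y) → eval Gen σ t Gen.≈ (t ⟪ σ ⟫)
    eval-Gen σ (var y)     = Gen.≈-refl {σ y}
    eval-Gen σ (node o ts) =
      Gen.⟦⟧-cong o {λ i → eval Gen σ (ts i)} {λ i → ts i ⟪ σ ⟫} (λ i → eval-Gen σ (ts i))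

    F≈Φ : ∀ t → fun F t Gen.≈ Φ t
    F≈Φ t = begin
      fun F t                         ≈⟨ hom-eval Gen F t ⟩
      eval Gen (fun F ∘ var) t        ≈⟨ eval-Gen (fun F ∘ var) t ⟩
      Φ t                             ∎
      where open AlgebraReasoning Gen

    L-holds : ∀ {s t} → (s , t) ∈ L → s Gen.≈ t
    L-holds st∈L with ∈-++⁻ _ st∈L
    ... | inj₁ st∈gens with ∈-map⁻ (λ q → var q , Φ (fun G (var q))) st∈gens
    ...   | q , _ , refl = begin
      var q                    ≈⟨ F∘G≈id (var q) ⟨
      fun F (fun G (var q))    ≈⟨ F≈Φ (fun G (var q)) ⟩
      Φ (fun G (var q))        ∎
      where open AlgebraReasoning Gen
    L-holds st∈L | inj₂ st∈rels with ∈-map⁻ (Product.map Φ Φ) st∈rels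
    ...   | (l , r) , lr∈P′ , refl = begin
      Φ l       ≈⟨ F≈Φ l ⟨
      fun F l   ≈⟨ cong F (rel lr∈P′) ⟩
      fun F r   ≈⟨ F≈Φ r ⟩
      Φ r       ∎
      where open AlgebraReasoning Gen

    sound : ∀ {u v} → listRel L ⊢ u ≐ v → u ⟪ a ⟫ ≐ v ⟪ a ⟫
    sound {u} {v} u≐v = Equivalence.to (Gen≈⇔≐ {u} {v})
      (eval-Derive (Alg (Free k)) (Alg-isEAlgebra _) a L-holds u≐v)

    G-⟪⟫ : ∀ u → listRel (Presentation.rels P′) ⊢ fun G u ≐ u ⟪ fun G ∘ var ⟫
    G-⟪⟫ (var q)     = drefl
    G-⟪⟫ (node o us) = dtrans (pres G o us) (dcong o (λ i → G-⟪⟫ (us i)))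

    Φ-Derive : ∀ {s t} → listRel (Presentation.rels P′) ⊢ s ≐ t → listRel L ⊢ Φ s ≐ Φ t
    Φ-Derive = ⟪⟫-Derive _ λ st∈P′ → rel (∈-++⁺ʳ _ (∈-map⁺ (Product.map Φ Φ) st∈P′))

    ≐Φ∘G : ∀ u → listRel L ⊢ u ≐ Φ (fun G u)
    ≐Φ∘G u = begin
      u                              ≈⟨ ⟪var⟫ u ⟨
      u ⟪ var ⟫                      ≈⟨ ⟪⟫-cong-occurs u _ _
                                          (λ q _ → rel (∈-++⁺ˡ (∈-map⁺ _ (∈-allFin q)))) ⟩
      u ⟪ (λ q → Φ (fun G (var q))) ⟫ ≈⟨ ⟪⟫-∘ u (fun G ∘ var) (fun F ∘ var) ⟨
      Φ (u ⟪ fun G ∘ var ⟫)          ≈⟨ Φ-Derive (G-⟪⟫ u) ⟨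
      Φ (fun G u)                    ∎
      where open AlgebraReasoning (TermAlg (Fin n) (listRel L))

    complete : ∀ {u v} → u ⟪ a ⟫ ≐ v ⟪ a ⟫ → listRel L ⊢ u ≐ v
    complete {u} {v} u≐v =
      dtrans (≐Φ∘G u)
        (dtrans (Φ-Derive (cong G (Equivalence.from (Gen≈⇔≐ {u} {v}) u≐v))) (dsym (≐Φ∘G v)))

  finiteKernel : (n : ℕ) (σ : Fin n → Term S ℕ) → ∃ (PresentsKernel σ)
  finiteKernel n σ = proj₁ kernelᶠ , λ {u} {v} → ⇔.trans (proj₂ kernelᶠ) (⟪a⟫⇔⟪σ⟫ u v)
    where
    k : ℕ
    k = varBound σ
    shrink : ℕ → Term S (Fin k)
    shrink y = var (y mod k)
    expand : Fin k → Term S ℕ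
    expand j = var (toℕ j)
    a : Fin n → Term S (Fin k)
    a q = σ q ⟪ shrink ⟫
    kernelᶠ : ∃ (PresentsKernel a)
    kernelᶠ = finiteKernelᶠ n k a

    expand-a : ∀ q → a q ⟪ expand ⟫ ≐ σ q
    expand-a q = begin
      σ q ⟪ shrink ⟫ ⟪ expand ⟫              ≈⟨ ⟪⟫-∘ (σ q) shrink expand ⟩
      σ q ⟪ (λ y → var (toℕ (y mod k))) ⟫    ≈⟨ ⟪⟫-cong-occurs (σ q) _ var (λ y y∈σq → reflexive
                                                  (Eq.cong var (toℕ-mod (occurs⇒<varBound σ q y∈σq)))) ⟩
      σ q ⟪ var ⟫                            ≈⟨ ⟪var⟫ (σ q) ⟩
      σ q                                    ∎
      where open AlgebraReasoning TermE

    ⟪a⟫⇔⟪σ⟫ : ∀ u v → (u ⟪ a ⟫ ≐ v ⟪ a ⟫) ⇔ (u ⟪ σ ⟫ ≐ v ⟪ σ ⟫)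
    ⟪a⟫⇔⟪σ⟫ u v = mk⇔
      (λ ua≐va → dtrans (dsym (expanded u)) (dtrans (⟪⟫-≐ expand ua≐va) (expanded v)))
      (λ uσ≐vσ → dtrans (dsym (⟪⟫-∘ u σ shrink))
                   (dtrans (⟪⟫-≐ shrink uσ≐vσ) (⟪⟫-∘ v σ shrink)))
      where
      expanded : ∀ w → w ⟪ a ⟫ ⟪ expand ⟫ ≐ w ⟪ σ ⟫
      expanded w = dtrans (⟪⟫-∘ w a expand) (⟪⟫-cong-occurs w _ σ (λ q _ → expand-a q))

module Reductions (S : Signature) (E : Theory S) where
  open StandardUnification S E

  record Reduction (P : Problem S E) : Set where
    field
      problems         : List Equations
      lift             : Subst S E → Subst S E
      lift-unifier     : ∀ {es ρ} → es ∈ problems → IsStdUnifier es ρ → IsUnifier S E P (lift ρ)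
      lift-lessGeneral : ∀ {es τ ρ} → es ∈ problems → IsUnifier S E P τ →
                         LessGeneral S E (StdProblem S E es) τ ρ → LessGeneral S E P τ (lift ρ)
      cover            : ∀ {τ} → IsUnifier S E P τ →
                         ∃ λ es → es ∈ problems × IsStdUnifier es τ

  module _ {P : Problem S E} (R : Reduction P) where
    open Reduction R

    reduction-basis : Finitary S E → Σ (List (Subst S E)) (IsBasis S E P)
    reduction-basis finitary = concatMap liftedBasis problems , unifiers , covered
      where
      liftedBasis : Equations → List (Subst S E)
      liftedBasis es = map lift (proj₁ (finitary es))

      unifiers : All (IsUnifier S E P) (concatMap liftedBasis problems)
      unifiers = AllP.concat⁺ (AllP.map⁺ (All.tabulate λ es∈ →
                   AllP.map⁺ (All.map (lift-unifier es∈) (proj₁ (proj₂ (finitary _))))))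

      covered : ∀ τ → IsUnifier S E P τ →
                Any (LessGeneral S E P τ) (concatMap liftedBasis problems)
      covered τ τ-unifies with cover τ-unifies
      ... | es , es∈ , τ-unifies-es = AnyP.concat⁺ (AnyP.map⁺ (lose es∈ (AnyP.map⁺
              (Any.map (lift-lessGeneral es∈ τ-unifies)
                       (proj₂ (proj₂ (finitary es)) τ τ-unifies-es)))))

    reduction-mgu : Unitary S E → length problems ≡ 1 →
                    Unifiable S E P → Σ (Subst S E) (IsMostGeneral S E P)
    reduction-mgu unitary single (τ₀ , τ₀-unifies) =
      lift ρ , (lift-unifier es∈ ρ-unifies ∷ []) , mostGeneral
      where
      es : Equations
      es = proj₁ (cover τ₀-unifies)
      es∈ : es ∈ problems
      es∈ = proj₁ (proj₂ (cover τ₀-unifies))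
      mgu : Σ (Subst S E) (IsMostGeneral S E (StdProblem S E es))
      mgu = unitary es (τ₀ , proj₂ (proj₂ (cover τ₀-unifies)))
      ρ : Subst S E
      ρ = proj₁ mgu
      ρ-unifies : IsStdUnifier es ρ
      ρ-unifies = All.head (proj₁ (proj₂ mgu))

      mostGeneral : ∀ τ → IsUnifier S E P τ → Any (LessGeneral S E P τ) (lift ρ ∷ [])
      mostGeneral τ τ-unifies with cover τ-unifies
      ... | es′ , es′∈ , τ-unifies-es′ rewrite length≡1⇒≡ problems single es′∈ es∈ =
        here (lift-lessGeneral es∈ τ-unifies
               (AnyP.singleton⁻ (proj₂ (proj₂ mgu) τ τ-unifies-es′)))

    reduction-decidable : Decidable S E → Dec (Unifiable S E P)
    reduction-decidable decidable with any? decidable problems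
    ... | yes some with find some
    ...   | es , es∈ , (ρ , ρ-unifies) = yes (lift ρ , lift-unifier es∈ ρ-unifies)
    reduction-decidable decidable | no none =
      no λ (τ , τ-unifies) → let es , es∈ , τ-unifies-es = cover τ-unifies
                             in none (lose es∈ (τ , τ-unifies-es))

module Encoding (S : Signature) (E : Theory S) (P : Problem S E) where
  open Syntax S
  open Equational S E
  open Presentations S E
  open StandardUnification S E
  open SubobjectEquations using (equations)
  open Reductions S E

  private
    C : List ℕ
    C = Problem.C P
    eqs : Equations
    eqs = Problem.eqs P

  N : ℕ
  N = suc (max 0 (C ++ᴸ map equationMaxVar eqs))
    where
    equationMaxVar : Term S ℕ × Term S ℕ → ℕ
    equationMaxVar (φ , ψ) = maxVar φ ⊔ maxVar ψ

  problemVar<N : ∀ {x} → ProblemVar S E P x → x < N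
  problemVar<N (inj₁ x∈C)   =
    s≤s (v≤max⁺ 0 _ (inj₂ (AnyP.++⁺ˡ (Any.map (λ { refl → ≤-refl }) x∈C))))
  problemVar<N (inj₂ x∈eqs) =
    s≤s (v≤max⁺ 0 _ (inj₂ (AnyP.++⁺ʳ C (AnyP.map⁺ (Any.map occurs⇒≤ x∈eqs)))))
    where
    occurs⇒≤ : ∀ {x φ ψ} → Occurs S x φ ⊎ Occurs S x ψ → x ≤ maxVar φ ⊔ maxVar ψ
    occurs⇒≤ {φ = φ} (inj₁ x∈φ) = ≤-trans (occurs⇒≤maxVar φ x∈φ) (m≤m⊔n _ _)
    occurs⇒≤ {ψ = ψ} (inj₂ x∈ψ) = ≤-trans (occurs⇒≤maxVar ψ x∈ψ) (m≤n⊔m _ _)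

  lhs<N : ∀ {φ ψ x} → (φ , ψ) ∈ eqs → Occurs S x φ → x < N
  lhs<N e∈ x∈φ = problemVar<N (inj₂ (Any.map (λ { refl → inj₁ x∈φ }) e∈))

  rhs<N : ∀ {φ ψ x} → (φ , ψ) ∈ eqs → Occurs S x ψ → x < N
  rhs<N e∈ x∈ψ = problemVar<N (inj₂ (Any.map (λ { refl → inj₂ x∈ψ }) e∈))

  W : Pres
  W = Free N

  bySide : {A : Set} → (ℕ → A) → (ℕ → A) → ℕ → A
  bySide onC offC x with x ∈? C
  ... | yes _ = onC x
  ... | no  _ = offC x

  bySide-∈ : {A : Set} {onC offC : ℕ → A} {x : ℕ} → x ∈ C → bySide onC offC x ≡ onC x
  bySide-∈ {x = x} x∈C with x ∈? C
  ... | yes _   = refl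
  ... | no  x∉C = contradiction x∈C x∉C

  bySide-∉ : {A : Set} {onC offC : ℕ → A} {x : ℕ} → x ∉ C → bySide onC offC x ≡ offC x
  bySide-∉ {x = x} x∉C with x ∈? C
  ... | yes x∈C = contradiction x∈C x∉C
  ... | no  _   = refl

  -- Restricted variables go to the copy V, the others to the copy W of Free (N + N) = V × W;
  -- x mod N is x itself for every variable of P.
  place : ℕ → Fin (N + N)
  place = bySide (λ x → (x mod N) ↑ˡ N) (λ x → N ↑ʳ (x mod N))

  place-∈ : ∀ {x} → x ∈ C → place x ≡ (x mod N) ↑ˡ N
  place-∈ = bySide-∈ {onC = λ x → (x mod N) ↑ˡ N} {offC = λ x → N ↑ʳ (x mod N)}

  place-∉ : ∀ {x} → x ∉ C → place x ≡ N ↑ʳ (x mod N)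
  place-∉ = bySide-∉ {onC = λ x → (x mod N) ↑ˡ N} {offC = λ x → N ↑ʳ (x mod N)}

  placeTerm : Term S ℕ → Term S (Fin (N + N))
  placeTerm φ = φ ⟪ var ∘ place ⟫

  placedEquations : List (Term S (Fin (N + N)) × Term S (Fin (N + N)))
  placedEquations = map (Product.map placeTerm placeTerm) eqs

  T : RegSub S E (Free (N + N))
  T = (⟨ N + N ∣ placedEquations ⟩ , quotientHom _ placedEquations) , quotientHom-isRegularMono _ _

  placed-equation : (A : Algebra S) (h : Hom (Alg (Free (N + N))) A) (v : ℕ → Algebra.Carrier A) →
                    (∀ x → x < N → Algebra._≈_ A (fun h (var (place x))) (v x)) →
                    ∀ {φ ψ} → (φ , ψ) ∈ eqs →
                    Algebra._≈_ A (fun h (placeTerm φ)) (fun h (placeTerm ψ))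
                      ⇔ Algebra._≈_ A (eval A v φ) (eval A v ψ)
  placed-equation A h v h≈v {φ} {ψ} e∈ = mk⇔
    (λ hφ≈hψ → ≈-trans (≈-sym (value φ (lhs<N e∈))) (≈-trans hφ≈hψ (value ψ (rhs<N e∈))))
    (λ vφ≈vψ → ≈-trans (value φ (lhs<N e∈)) (≈-trans vφ≈vψ (≈-sym (value ψ (rhs<N e∈)))))
    where
    open AlgebraReasoning A
    value : ∀ t → (∀ {x} → Occurs S x t → x < N) → fun h (placeTerm t) ≈ eval A v t
    value t t<N = ≈-trans (hom-⟪⟫ A h (var ∘ place) t)
                          (eval-cong-occurs A _ v t (λ x x∈t → h≈v x (t<N x∈t)))

  -- Shifting by N keeps the values of non-restricted variables clear of C, which lies below N.
  shift : ℕ → Term S ℕ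
  shift y = var (N + y)

  lift : Subst S E → Subst S E
  lift ρ = bySide var (λ x → ρ x ⟪ shift ⟫)

  lift-∈ : ∀ ρ {x} → x ∈ C → lift ρ x ≡ var x
  lift-∈ ρ = bySide-∈ {onC = var} {offC = λ x → ρ x ⟪ shift ⟫}

  lift-∉ : ∀ ρ {x} → x ∉ C → lift ρ x ≡ ρ x ⟪ shift ⟫
  lift-∉ ρ = bySide-∉ {onC = var} {offC = λ x → ρ x ⟪ shift ⟫}

  lift-avoids-C : ∀ ρ {q} → q ∉ C → ∀ {c} → c ∈ C → ¬ Occurs S c (lift ρ q)
  lift-avoids-C ρ {q} q∉C c∈C c∈liftρq
    with occurs-⟪⟫ (ρ q) shift (Eq.subst (Occurs S _) (lift-∉ ρ q∉C) c∈liftρq)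
  ... | y , _ , here = m+n≮m N y (problemVar<N (inj₁ c∈C))

  -- The shifted unifier solves the defining pairs of B, so it factors through B; copaired with
  -- the identity on V it evaluates the pullback π₂⁻¹(B) ≤ T, hence solves the equations of P.
  module Soundness (B : RegSub S E W) (B≤T : InvLe S E (π₂ N N) B T)
                   {ρ : Subst S E} (ρ-unifies : IsStdUnifier (equations B) ρ) where
    open RegularSubobject B
    open SubobjectEquations B using (unifierHom)
    open π₂-Pullback N carrier inclusion

    shifted : Subst S E
    shifted x = ρ x ⟪ shift ⟫

    shiftedHom : Hom (Alg ⟨ N ∣ definingPairs ⟩) TermE
    shiftedHom = unifierHom (stdUnifier-instance shift ρ-unifies)

    onB : Hom (Alg carrier) TermE
    onB = shiftedHom ∘H proj₁ quotient⊑

    open Copair TermE TermAlg-isEAlgebra (var ∘ toℕ) onB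

    copair-m′-place : ∀ x → x < N → fun copair (fun m′ (var (place x))) ≐ lift ρ x
    copair-m′-place x x<N = bySide-value (x ∈? C)
      where
      open AlgebraReasoning TermE
      q : Fin N
      q = x mod N
      bySide-value : Dec (x ∈ C) → fun copair (fun m′ (var (place x))) ≐ lift ρ x
      bySide-value (yes x∈C) = begin
        fun copair (fun m′ (var (place x)))     ≡⟨ Eq.cong (fun copair ∘ fun m′ ∘ var) (place-∈ x∈C) ⟩
        fun copair (fun m′ (var (q ↑ˡ N)))      ≡⟨ Eq.cong (fun copair) (m′-↑ˡ q) ⟩
        fun copair (var (q ↑ˡ gensB))           ≈⟨ copair-↑ˡ q ⟩
        var (toℕ q)                             ≡⟨ Eq.cong var (toℕ-mod x<N) ⟩
        var x                                   ≡⟨ lift-∈ ρ x∈C ⟨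
        lift ρ x                                ∎
      bySide-value (no x∉C) = begin
        fun copair (fun m′ (var (place x)))     ≡⟨ Eq.cong (fun copair ∘ fun m′ ∘ var) (place-∉ x∉C) ⟩
        fun copair (fun m′ (var (N ↑ʳ q)))      ≡⟨ Eq.cong (fun copair) (m′-↑ʳ q) ⟩
        fun copair (liftTerm (fun inclusion (var q)))  ≈⟨ copair-liftTerm _ ⟩
        fun onB (fun inclusion (var q))         ≈⟨ cong shiftedHom (proj₂ quotient⊑ (var q)) ⟩
        shifted (toℕ q)                         ≡⟨ Eq.cong shifted (toℕ-mod x<N) ⟩
        shifted x                               ≡⟨ lift-∉ ρ x∉C ⟨
        lift ρ x                                ∎

    lift-unifier : IsUnifier S E P (lift ρ)
    lift-unifier =
      (λ c c∈C → lift-∈ ρ c∈C) , (λ q q∉C c c∈C → lift-avoids-C ρ q∉C c∈C) , All.tabulate unifies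
      where
      k : Pullback ⇒ ⟨ N + N ∣ placedEquations ⟩
      k = proj₁ (B≤T Pullback m′ f′ isPullback)
      k≈m′ : ∀ t → listRel (Presentation.rels Pullback) ⊢ fun k t ≐ fun m′ t
      k≈m′ = proj₂ (B≤T Pullback m′ f′ isPullback)

      unifies : ∀ {φ ψ} → (φ , ψ) ∈ eqs → φ ⟪ lift ρ ⟫ ≐ ψ ⟪ lift ρ ⟫
      unifies {φ} {ψ} e∈ = begin
        φ ⟪ lift ρ ⟫                ≈⟨ eval-TermAlg (lift ρ) φ ⟨
        eval TermE (lift ρ) φ       ≈⟨ Equivalence.to (placed-equation TermE (copair ∘H m′) (lift ρ)
                                                          copair-m′-place e∈)
                                         (cong copair m′φ≈m′ψ) ⟩
        eval TermE (lift ρ) ψ       ≈⟨ eval-TermAlg (lift ρ) ψ ⟩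
        ψ ⟪ lift ρ ⟫                ∎
        where
        open AlgebraReasoning TermE
        m′φ≈m′ψ : listRel (Presentation.rels Pullback) ⊢ fun m′ (placeTerm φ) ≐ fun m′ (placeTerm ψ)
        m′φ≈m′ψ = dtrans (dsym (k≈m′ _))
                    (dtrans (cong k (rel (∈-map⁺ (Product.map placeTerm placeTerm) e∈)))
                            (k≈m′ _))

  module Completeness (coherent : Coherent S E) (it : IT S E)
                      {τ : Subst S E} (τ-unifies : IsUnifier S E P τ) where
    open Kernels S E coherent

    τᶠ : Fin N → Term S ℕ
    τᶠ q = τ (toℕ q)

    L : List (Term S (Fin N) × Term S (Fin N))
    L = proj₁ (finiteKernel N τᶠ)

    L-presents : PresentsKernel τᶠ L
    L-presents = proj₂ (finiteKernel N τᶠ)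

    Kernel : RegSub S E W
    Kernel = (⟨ N ∣ L ⟩ , quotientHom N L) , quotientHom-isRegularMono N L

    τHom : Hom (Alg ⟨ N ∣ L ⟩) TermE
    τHom = record { fun = _⟪ τᶠ ⟫ ; cong = Equivalence.to L-presents ; pres = λ _ _ → drefl }

    -- IT amalgamates the pullback Q with the term algebra over the injective τHom. In the
    -- amalgam the placed equations of P take their values under τ, and h′ is injective.
    kernel-pullback≤T : InvLe S E (π₂ N N) Kernel T
    kernel-pullback≤T Q m f (commutes , _) = factorHom (Alg Q) m m-resp , λ _ → drefl
      where
      amalgam : Σ (EAlgebra S E) λ 𝓔 → Σ (Hom TermE (alg 𝓔)) λ h →
                Σ (Hom (Alg Q) (alg 𝓔)) λ h′ → Injective h′ × (h′ ∘H f) ≈H (h ∘H τHom)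
      amalgam = it (record { alg = Alg ⟨ N ∣ L ⟩ ; model = Alg-isEAlgebra _ })
                   (record { alg = Alg Q ; model = Alg-isEAlgebra Q })
                   (record { alg = TermE ; model = TermAlg-isEAlgebra })
                   f τHom (Equivalence.from L-presents)
      𝓔 : EAlgebra S E
      𝓔 = proj₁ amalgam
      h : Hom TermE (alg 𝓔)
      h = proj₁ (proj₂ amalgam)
      h′ : Hom (Alg Q) (alg 𝓔)
      h′ = proj₁ (proj₂ (proj₂ amalgam))
      h′-injective : Injective h′
      h′-injective = proj₁ (proj₂ (proj₂ (proj₂ amalgam)))
      h′∘f≈h∘τHom : (h′ ∘H f) ≈H (h ∘H τHom)
      h′∘f≈h∘τHom = proj₂ (proj₂ (proj₂ (proj₂ amalgam)))

      open AlgebraReasoning (alg 𝓔)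

      onV onW v : ℕ → Carrier
      onV y = fun h′ (fun m (var (place y)))
      onW y = fun h (var y)
      v = bySide onV onW

      h′-m-place : ∀ x → x < N → fun h′ (fun m (var (place x))) ≈ eval (alg 𝓔) v (τ x)
      h′-m-place x x<N = bySide-value (x ∈? C)
        where
        q : Fin N
        q = x mod N
        v≈h∘var : ∀ y → Occurs S y (τ x) → x ∉ C → fun h (var y) ≈ v y
        v≈h∘var y y∈τx x∉C = reflexive (Eq.sym (bySide-∉ {onC = onV} {offC = onW} {x = y}
                               (λ y∈C → proj₁ (proj₂ τ-unifies) x x∉C y y∈C y∈τx)))
        bySide-value : Dec (x ∈ C) → fun h′ (fun m (var (place x))) ≈ eval (alg 𝓔) v (τ x)
        bySide-value (yes x∈C) = begin
          fun h′ (fun m (var (place x)))     ≡⟨ bySide-∈ {onC = onV} {offC = onW} x∈C ⟨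
          v x                                ≡⟨ Eq.cong (eval (alg 𝓔) v) (proj₁ τ-unifies x x∈C) ⟨
          eval (alg 𝓔) v (τ x)               ∎
        bySide-value (no x∉C) = begin
          fun h′ (fun m (var (place x)))     ≡⟨ Eq.cong (fun h′ ∘ fun m ∘ var) (place-∉ x∉C) ⟩
          fun h′ (fun m (var (N ↑ʳ q)))      ≈⟨ cong h′ (commutes (var q)) ⟩
          fun h′ (fun f (var q))             ≈⟨ h′∘f≈h∘τHom (var q) ⟩
          fun h (τ (toℕ q))                  ≡⟨ Eq.cong (fun h ∘ τ) (toℕ-mod x<N) ⟩
          fun h (τ x)                        ≈⟨ hom-eval (alg 𝓔) h (τ x) ⟩
          eval (alg 𝓔) (fun h ∘ var) (τ x)   ≈⟨ eval-cong-occurs (alg 𝓔) (fun h ∘ var) v (τ x)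
                                                  (λ y y∈τx → v≈h∘var y y∈τx x∉C) ⟩
          eval (alg 𝓔) v (τ x)               ∎

      m-resp : ∀ {s t} → (s , t) ∈ placedEquations → Algebra._≈_ (Alg Q) (fun m s) (fun m t)
      m-resp = ∈-map-elim (λ (s , t) → Algebra._≈_ (Alg Q) (fun m s) (fun m t)) λ e∈ →
        h′-injective (Equivalence.from
          (placed-equation (alg 𝓔) (h′ ∘H m) vτ h′-m-place e∈) (τ-unifies-in-𝓔 e∈))
        where
        vτ : ℕ → Carrier
        vτ = eval (alg 𝓔) v ∘ τ
        τ-unifies-in-𝓔 : ∀ {φ ψ} → (φ , ψ) ∈ eqs → eval (alg 𝓔) vτ φ ≈ eval (alg 𝓔) vτ ψ
        τ-unifies-in-𝓔 {φ} {ψ} e∈ = begin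
          eval (alg 𝓔) vτ φ          ≈⟨ eval-⟪⟫ (alg 𝓔) v τ φ ⟨
          eval (alg 𝓔) v (φ ⟪ τ ⟫)   ≈⟨ eval-Derive (alg 𝓔) (model 𝓔) v (λ ())
                                          (All.lookup (proj₂ (proj₂ τ-unifies)) e∈) ⟩
          eval (alg 𝓔) v (ψ ⟪ τ ⟫)   ≈⟨ eval-⟪⟫ (alg 𝓔) v τ ψ ⟩
          eval (alg 𝓔) vτ ψ          ∎

    kernel⊑⇒unifier : (B : RegSub S E W) → proj₁ Kernel ⊑ proj₁ B → IsStdUnifier (equations B) τ
    kernel⊑⇒unifier B Kernel⊑B = SubobjectEquations.unifies-pairs⇒unifier B λ st∈pairs →
      Equivalence.to L-presents
        (RegularSubobject.definingPairs-hold B (proj₁ Kernel) Kernel⊑B st∈pairs)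

    unifier-covered : (Bs : List (RegSub S E W)) →
                      IsForallFactorization S E (π₁ N N) (π₂ N N) T Bs →
                      ∃ λ B → B ∈ Bs × IsStdUnifier (equations B) τ
    unifier-covered Bs (_ , Bs-maximal) = Product.map₂ (λ {B} → Product.map₂ (kernel⊑⇒unifier B))
                                            (find (Bs-maximal Kernel kernel-pullback≤T))

  unshift : Subst S E → Subst S E
  unshift θ y with y <? N
  ... | yes _ = var y
  ... | no  _ = θ (y ∸ N)

  unshift-< : ∀ θ {y} → y < N → unshift θ y ≡ var y
  unshift-< θ {y} y<N with y <? N
  ... | yes _   = refl
  ... | no  y≮N = contradiction y<N y≮N

  unshift-shift : ∀ θ y → unshift θ (N + y) ≡ θ y
  unshift-shift θ y with N + y <? N
  ... | yes N+y<N = contradiction N+y<N (m+n≮m N y)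
  ... | no  _     = Eq.cong θ (m+n∸m≡n N y)

  lift-lessGeneral : (B : RegSub S E W) {τ ρ : Subst S E} → IsUnifier S E P τ →
                     LessGeneral S E (StdProblem S E (equations B)) τ ρ → LessGeneral S E P τ (lift ρ)
  lift-lessGeneral B {τ} {ρ} τ-unifies (θ , τ≐ρθ) =
    unshift θ , λ x x∈P → bySide-instance x (problemVar<N x∈P) (x ∈? C)
    where
    open AlgebraReasoning TermE
    bySide-instance : ∀ x → x < N → Dec (x ∈ C) → τ x ≐ lift ρ x ⟪ unshift θ ⟫
    bySide-instance x x<N (yes x∈C) = begin
      τ x                                ≡⟨ proj₁ τ-unifies x x∈C ⟩
      var x                              ≡⟨ unshift-< θ x<N ⟨
      var x ⟪ unshift θ ⟫                ≡⟨ Eq.cong (_⟪ unshift θ ⟫) (lift-∈ ρ x∈C) ⟨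
      lift ρ x ⟪ unshift θ ⟫             ∎
    bySide-instance x x<N (no x∉C) = begin
      τ x                                ≈⟨ τ≐ρθ x (SubobjectEquations.equations-var B x<N) ⟩
      ρ x ⟪ θ ⟫                          ≈⟨ ⟪⟫-cong-occurs (ρ x) _ _
                                               (λ y _ → reflexive (unshift-shift θ y)) ⟨
      ρ x ⟪ (λ y → unshift θ (N + y)) ⟫  ≈⟨ ⟪⟫-∘ (ρ x) shift (unshift θ) ⟨
      ρ x ⟪ shift ⟫ ⟪ unshift θ ⟫        ≡⟨ Eq.cong (_⟪ unshift θ ⟫) (lift-∉ ρ x∉C) ⟨
      lift ρ x ⟪ unshift θ ⟫             ∎

  reduction : Coherent S E → IT S E → (Bs : List (RegSub S E W)) →
              IsForallFactorization S E (π₁ N N) (π₂ N N) T Bs → Reduction P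
  Reduction.problems (reduction _ _ Bs _) = map equations Bs
  Reduction.lift (reduction _ _ _ _) = lift
  Reduction.lift-unifier (reduction _ _ Bs (Bs≤T , _)) {ρ = ρ} =
    ∈-map-elim (λ es → IsStdUnifier es ρ → IsUnifier S E P (lift ρ))
               (λ {B} B∈Bs → Soundness.lift-unifier B (All.lookup Bs≤T B∈Bs))
  Reduction.lift-lessGeneral (reduction _ _ Bs _) {τ = τ} {ρ} =
    ∈-map-elim (λ es → IsUnifier S E P τ → LessGeneral S E (StdProblem S E es) τ ρ →
                       LessGeneral S E P τ (lift ρ))
               (λ {B} _ → lift-lessGeneral B {τ} {ρ})
  Reduction.cover (reduction coherent it Bs factorization) τ-unifies =
    Product.map equations (Product.map₁ (∈-map⁺ equations))
      (Completeness.unifier-covered coherent it τ-unifies Bs factorization)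

  forallFactorization⇒reduction : Coherent S E → IT S E → ForallFactorizationProperty S E →
                                  Reduction P
  forallFactorization⇒reduction coherent it ffp =
    reduction coherent it (proj₁ factorization) (proj₂ factorization)
    where
    factorization : Σ (List (RegSub S E W)) (IsForallFactorization S E (π₁ N N) (π₂ N N) T)
    factorization = ffp _ _ _ (π₁ N N) (π₂ N N) (free-isProduct N N) T

  singularForallFactorization⇒reduction :
    Coherent S E → IT S E → SingularForallFactorizationProperty S E →
    Σ (Reduction P) λ R → length (Reduction.problems R) ≡ 1
  singularForallFactorization⇒reduction coherent it sffp =
    reduction coherent it Bs (proj₂ (proj₂ factorization)) ,
    Eq.trans (length-map equations Bs) (proj₁ (proj₂ factorization))
    where
    factorization : Σ (List (RegSub S E W)) λ Bs →
                    length Bs ≡ 1 × IsForallFactorization S E (π₁ N N) (π₂ N N) T Bs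
    factorization = sffp _ _ _ (π₁ N N) (π₂ N N) (free-isProduct N N) T
    Bs : List (RegSub S E W)
    Bs = proj₁ factorization

open Encoding
open Reductions

corollary5p5 : (S : Signature) (E : Theory S) →
    HasConstant S →
    IT S E → Coherent S E → ForallFactorizationProperty S E →
    (Finitary S E → FinitarySVR S E) ×
    (Unitary S E → SingularForallFactorizationProperty S E → UnitarySVR S E) ×
    (Decidable S E → ForallFactorizationProperty S E → DecidableSVR S E)
corollary5p5 S E _ it coherent ffp =
  (λ finitary P → reduction-basis S E (forallFactorization⇒reduction S E P coherent it ffp) finitary) ,
  (λ unitary sffp P →
     let R , single = singularForallFactorization⇒reduction S E P coherent it sffp
     in reduction-mgu S E R unitary single) ,
  (λ decidable ffp′ P →
     reduction-decidable S E (forallFactorization⇒reduction S E P coherent it ffp′) decidable)
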